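{- Let $n\ge 2$ be an integer and let $P_n$ be the path on $n$ vertices. Then $\gamma_{Zg}(P_n)=\left\lceil\frac{n}{2}\right\rceil-1$ if $n\equiv 3\pmod 4$, and $\gamma_{Zg}(P_n)=\left\lceil\frac{n}{2}\right\rceil$ otherwise.
   Context: $N(v)$ and $N[v]=N(v)\cup\{v\}$ denote the open and closed neighborhood of a vertex $v$. Z-domination game: two players, Dominator and Staller, alternately select vertices $v_1,v_2,\ldots$ of an isolate-free graph $G$. The $i$-th move $v_i$ is legal if $N(v_i)\setminus\bigcup_{j=1}^{i-1}N[v_j]\neq\emptyset$. The game ends when no legal move is available. Dominator wants to minimize the total number of moves, Staller wants to maximize it. $\gamma_{Zg}(G)$ is the total number of moves played (by both players) when Dominator moves first and both players play optimally. -}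

module Defs where

open import Data.Fin.Base using (Fin; toℕ)
open import Data.Fin.Subset using (Subset; _∈_; _⊂_; _∪_; _─_; ∁; ⋃; ⁅_⁆; ∣_∣; Nonempty)
open import Data.Fin.Subset.Properties
  using (nonempty?; p⊆p∪q; q⊆p∪q; p─q⊆p; p⊂q⇒∁p⊃∁q; p⊂q⇒∣p∣<∣q∣; p─q─q≡p─q; x∈p∩q⁺; p∩q≢∅⇒p─q⊂p; ⊂-irref)
open import Data.List.Base using (List; []; _∷_; map; mapMaybe; allFin)
open import Data.List.Extrema.Nat using (min; max)
import Data.Maybe.Base as Maybe
open import Data.Nat.Base using (ℕ; suc; _<_)
open import Data.Nat.Induction using (<-wellFounded)
open import Data.Nat.Properties using (_≟_; 1+n≢n)
open import Data.Product.Base using (∃; _,_)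
open import Data.Sum.Base using (_⊎_; inj₁; inj₂; swap)
open import Data.Vec.Base using (tabulate)
open import Induction.WellFounded using (Acc; acc)
open import Relation.Binary.Definitions using (Decidable; Irreflexive; Symmetric)
open import Relation.Binary.PropositionalEquality.Core using (_≡_; refl; sym)
open import Relation.Nullary.Decidable using (Dec; does; dec⇒maybe; _⊎-dec_)
open import Relation.Nullary.Negation using (¬_)

record Graph (n : ℕ) : Set₁ where
  field
    _∼_    : Fin n → Fin n → Set
    _∼?_   : Decidable _∼_
    symm   : Symmetric _∼_
    irrefl : Irreflexive _≡_ _∼_

path : ∀ n → Graph n
path n = record
  { _∼_    = λ i j → toℕ j ≡ suc (toℕ i) ⊎ toℕ i ≡ suc (toℕ j)
  ; _∼?_   = λ i j → (toℕ j ≟ suc (toℕ i)) ⊎-dec (toℕ i ≟ suc (toℕ j))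
  ; symm   = swap
  ; irrefl = λ { refl (inj₁ e) → 1+n≢n (sym e) ; refl (inj₂ e) → 1+n≢n (sym e) }
  }

data Player : Set where
  dominator staller : Player

opponent : Player → Player
opponent dominator = staller
opponent staller   = dominator

-- The value of a position for the player to move, given the values of the
-- available moves; without available moves the game is over.
optimum : Player → List ℕ → ℕ
optimum _         []       = 0
optimum dominator (k ∷ ks) = min k ks
optimum staller   (k ∷ ks) = max k ks

-- The game is usually restricted to isolate-free graphs. The rules make sense
-- for all graphs: an isolated vertex is simply never a legal move.
module ZGame {n : ℕ} (G : Graph n) where
  open Graph G

  N : Fin n → Subset n
  N v = tabulate (λ w → does (v ∼? w))

  N[_] : Fin n → Subset n
  N[ v ] = N v ∪ ⁅ v ⁆

  -- The vertices played so far, most recent first.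
  History : Set
  History = List (Fin n)

  dominated : History → Subset n
  dominated h = ⋃ (map N[_] h)

  Legal : History → Fin n → Set
  Legal h v = Nonempty (N v ─ dominated h)

  legal? : ∀ h v → Dec (Legal h v)
  legal? h v = nonempty? (N v ─ dominated h)

  legalMoves : ∀ h → List (∃ (Legal h))
  legalMoves h = mapMaybe (λ v → Maybe.map (v ,_) (dec⇒maybe (legal? h v))) (allFin n)

  undominated : History → ℕ
  undominated h = ∣ ∁ (dominated h) ∣

  legal⇒undominated< : ∀ {h v} → Legal h v → undominated (v ∷ h) < undominated h
  legal⇒undominated< {h} {v} (x , x∈N─D) = p⊂q⇒∣p∣<∣q∣ (p⊂q⇒∁p⊃∁q D⊂D′)
    where
    D = dominated h

    x∉D : ¬ (x ∈ D)
    x∉D x∈D = ⊂-irref (p─q─q≡p─q (N v) D) (p∩q≢∅⇒p─q⊂p (N v ─ D) D (x , x∈p∩q⁺ (x∈N─D , x∈D)))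

    D⊂D′ : D ⊂ dominated (v ∷ h)
    D⊂D′ = q⊆p∪q N[ v ] D , x , p⊆p∪q D (p⊆p∪q ⁅ v ⁆ (p─q⊆p (N v) D x∈N─D)) , x∉D

  -- The number of further moves under optimal play when p is to move after h.
  -- The accessibility argument only serves termination.
  remainingMoves : Player → ∀ h → Acc _<_ (undominated h) → ℕ
  remainingMoves p h (acc rs) = optimum p
    (map (λ (v , l) → suc (remainingMoves (opponent p) (v ∷ h) (rs (legal⇒undominated< {h} l))))
         (legalMoves h))

γZg : ∀ {n} → Graph n → ℕ
γZg G = remainingMoves dominator [] (<-wellFounded _)
  where open ZGame G

{-# OPTIONS --safe #-}

-- Staller can keep the progress in a round of two moves to at most four units,
-- and Dominator can raise it, in a suitable measure, to at least four. Staller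
-- can always dominate exactly one new vertex: if a dominated vertex a is next to
-- an undominated vertex b, then neither has been played, so a was dominated by
-- its other neighbour, and playing a dominates only b. For Dominator, weigh a
-- position by its number of undominated vertices plus twice its number of
-- undominated runs. A legal move splits a run only if it dominates three
-- vertices, so it lowers the weight by at least one, whereas playing the right
-- neighbour of the leftmost undominated vertex (its left neighbour, at the end of
-- the path) lowers the weight by at least three. A position that is not over
-- weighs at least three, so 2 can be subtracted from all weights, after which
-- both bounds start from n and obey the same recursion.
module Submission where

open import Defs
open import Data.Fin.Base using (Fin; zero; suc)
open import Data.Fin.Properties using (toℕ-injective) renaming (_≟_ to _≟ᶠ_)
open import Data.Fin.Subset
  using (Subset; Side; inside; outside; _∈_; _∉_; _⊆_; _∪_; ∁; ⊥; ⁅_⁆; ∣_∣; Nonempty)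
open import Data.Fin.Subset.Properties
  using ( drop-there; drop-not-there; ∉⊥; nonempty?; Empty-unique; ∣⊥∣≡0; ∣⁅x⁆∣≡1; x∈⁅x⁆; x∈⁅y⁆⇒x≡y
        ; p⊆q⇒∣p∣≤∣q∣; p⊆q⇒∁p⊇∁q; ∣∁p∣≡n∸∣p∣; x∈∁p⇒x∉p; x∉p⇒x∈∁p
        ; p⊆p∪q; q⊆p∪q; x∈p∪q⁺; x∈p∪q⁻; ∪-identityˡ; p─q⊆p; p─q─q≡p─q
        ; p∩q≢∅⇒p─q⊂p; x∈p∩q⁺; ⊂-irref; x∈p∧x∉q⇒x∈p─q )
open import Data.List.Base using ([]; _∷_; allFin)
open import Data.List.Extrema.Nat using (min≤v⁺; v≤min⁺; max≤v⁺; v≤max⁺)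
open import Data.List.Membership.Propositional using (lose)
open import Data.List.Membership.Propositional.Properties using (∈-allFin)
open import Data.List.Relation.Unary.All using (All; []; _∷_; universal)
import Data.List.Relation.Unary.All.Properties as All
open import Data.List.Relation.Unary.Any using (Any; here; there)
import Data.List.Relation.Unary.Any.Properties as Any
import Data.Maybe.Base as Maybe
open import Data.Maybe.Relation.Unary.Any using (just)
import Data.Maybe.Relation.Unary.Any as MAny
open import Data.Nat.Base
  using (ℕ; zero; suc; pred; _+_; _≤_; _<_; _∸_; _%_; ⌈_/2⌉; z≤n; s≤s)
open import Data.Nat.Induction using (<-wellFounded)
open import Data.Nat.Properties
open import Data.Product.Base using (∃; ∃₂; _×_; _,_; proj₁; proj₂)
open import Data.Sum.Base using (_⊎_; inj₁; inj₂)
open import Data.Unit.Base using (⊤)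
open import Data.Vec.Base using ([]; _∷_; here; there; tabulate)
open import Data.Vec.Properties using (lookup∘tabulate; []=⇒lookup; lookup⇒[]=)
open import Function.Base using (_∘_)
open import Induction.WellFounded using (Acc; acc)
open import Relation.Binary.PropositionalEquality.Core
  using (_≡_; _≢_; refl; sym; trans; cong; subst)
open import Relation.Nullary.Decidable
  using (yes; no; does; dec⇒maybe; dec-true)
open import Relation.Nullary.Negation using (¬_; contradiction)

-- Bounds on the optimum over a list of move values.

module _ {k : ℕ} where

  optimum-dominator-≤ : ∀ {ks} → Any (_≤ k) ks → optimum dominator ks ≤ k
  optimum-dominator-≤ {j ∷ js} (here j≤k) = min≤v⁺ j js (inj₁ j≤k)
  optimum-dominator-≤ {j ∷ js} (there ps) = min≤v⁺ j js (inj₂ ps)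

  -- The `Any` hypothesis excludes the empty list, whose optimum is 0.
  optimum-dominator-≥ : ∀ {ks} → Any (k ≤_) ks → All (k ≤_) ks → k ≤ optimum dominator ks
  optimum-dominator-≥ {_ ∷ _} _ (k≤j ∷ ps) = v≤min⁺ k≤j ps

  optimum-staller-≤ : ∀ {ks} → All (_≤ k) ks → optimum staller ks ≤ k
  optimum-staller-≤ []         = z≤n
  optimum-staller-≤ (j≤k ∷ ps) = max≤v⁺ j≤k ps

  optimum-staller-≥ : ∀ {ks} → Any (k ≤_) ks → k ≤ optimum staller ks
  optimum-staller-≥ {j ∷ js} (here k≤j) = v≤max⁺ j js (inj₁ k≤j)
  optimum-staller-≥ {j ∷ js} (there ps) = v≤max⁺ j js (inj₂ ps)

-- The game on an arbitrary graph.

module ZGameProperties {n : ℕ} (G : Graph n) where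
  open Graph G
  open ZGame G

  ∼⇒∈N : ∀ {v w} → v ∼ w → w ∈ N v
  ∼⇒∈N {v} {w} v∼w = lookup⇒[]= w (N v)
    (trans (lookup∘tabulate (λ u → does (v ∼? u)) w) (dec-true (v ∼? w) v∼w))

  ∈N⇒∼ : ∀ {v w} → w ∈ N v → v ∼ w
  ∈N⇒∼ {v} {w} w∈N with v ∼? w | trans (sym (lookup∘tabulate (λ u → does (v ∼? u)) w)) ([]=⇒lookup w∈N)
  ... | yes v∼w | _  = v∼w
  ... | no  _   | ()

  ∈N[]⁻ : ∀ {v w} → w ∈ N[ v ] → v ∼ w ⊎ v ≡ w
  ∈N[]⁻ {v} w∈N[v] with x∈p∪q⁻ (N v) ⁅ v ⁆ w∈N[v]
  ... | inj₁ w∈N = inj₁ (∈N⇒∼ w∈N)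
  ... | inj₂ w∈v = inj₂ (sym (x∈⁅y⁆⇒x≡y v w∈v))

  ∈N[]⁺ : ∀ {v w} → v ∼ w ⊎ v ≡ w → w ∈ N[ v ]
  ∈N[]⁺ {v} (inj₁ v∼w)  = x∈p∪q⁺ (inj₁ (∼⇒∈N v∼w))
  ∈N[]⁺ {v} (inj₂ refl) = x∈p∪q⁺ (inj₂ (x∈⁅x⁆ v))

  ∈dominated⁻ : ∀ h {w} → w ∈ dominated h → ∃ λ v → w ∈ N[ v ] × N[ v ] ⊆ dominated h
  ∈dominated⁻ []      w∈⊥ = contradiction w∈⊥ ∉⊥
  ∈dominated⁻ (v ∷ h) w∈D with x∈p∪q⁻ N[ v ] (dominated h) w∈D
  ... | inj₁ w∈N[v] = v , w∈N[v] , p⊆p∪q (dominated h)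
  ... | inj₂ w∈D′ with ∈dominated⁻ h w∈D′
  ...   | u , w∈N[u] , N[u]⊆D′ = u , w∈N[u] , λ x∈N[u] → q⊆p∪q N[ v ] (dominated h) (N[u]⊆D′ x∈N[u])

  -- Relative to a set instead of a history, since inductions along the path pass to tails of the
  -- dominated set, which come with no history.
  LegalAt : Subset n → Fin n → Set
  LegalAt D v = ∃ λ w → v ∼ w × w ∉ D

  Legal⇒LegalAt : ∀ h {v} → Legal h v → LegalAt (dominated h) v
  Legal⇒LegalAt h {v} (w , w∈N─D) = w , ∈N⇒∼ (p─q⊆p (N v) D w∈N─D) , λ w∈D →
    ⊂-irref (p─q─q≡p─q (N v) D) (p∩q≢∅⇒p─q⊂p _ D (w , x∈p∩q⁺ (w∈N─D , w∈D)))
    where D = dominated h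

  LegalAt⇒Legal : ∀ h {v} → LegalAt (dominated h) v → Legal h v
  LegalAt⇒Legal h (w , v∼w , w∉D) = w , x∈p∧x∉q⇒x∈p─q (∼⇒∈N v∼w) w∉D

  module _ {h : History} {P : ∃ (Legal h) → Set} where

    -- `P` is asked for every legality proof because `legalMoves` carries the proof found by
    -- `legal?`, not the given `l`.
    Any-legalMoves : ∀ {v} → Legal h v → (∀ l → P (v , l)) → Any P (legalMoves h)
    Any-legalMoves {v} l Pv = Any.mapMaybe⁺ _ (allFin n) (Any.map⁺ (lose (∈-allFin v) just-P))
      where
      just-P : MAny.Any P (Maybe.map (v ,_) (dec⇒maybe (legal? h v)))
      just-P with legal? h v
      ... | yes l′ = just (Pv l′)
      ... | no  ¬l = contradiction l ¬l

  module _ {k : ℕ} (h : History) (rs : ∀ {y} → y < undominated h → Acc _<_ y) where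

    private
      after : Player → ∃ (Legal h) → ℕ
      after p (v , l) = suc (remainingMoves p (v ∷ h) (rs (legal⇒undominated< {h} l)))

    remainingMoves-dominator-≤ : ∀ v → Legal h v → (∀ l → after staller (v , l) ≤ k) →
                                 remainingMoves dominator h (acc rs) ≤ k
    remainingMoves-dominator-≤ v l ≤k = optimum-dominator-≤ (Any.map⁺ (Any-legalMoves {h} {v = v} l ≤k))

    remainingMoves-dominator-≥ : ∀ v → Legal h v → (∀ vl → k ≤ after staller vl) →
                                 k ≤ remainingMoves dominator h (acc rs)
    remainingMoves-dominator-≥ v l k≤ = optimum-dominator-≥
      (Any.map⁺ (Any-legalMoves {h} {v = v} l (λ l′ → k≤ (v , l′))))
      (All.map⁺ (universal k≤ (legalMoves h)))

    remainingMoves-staller-≤ : (∀ vl → after dominator vl ≤ k) →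
                               remainingMoves staller h (acc rs) ≤ k
    remainingMoves-staller-≤ ≤k = optimum-staller-≤ (All.map⁺ (universal ≤k (legalMoves h)))

    remainingMoves-staller-≥ : ∀ v → Legal h v → (∀ l → k ≤ after dominator (v , l)) →
                               k ≤ remainingMoves staller h (acc rs)
    remainingMoves-staller-≥ v l k≤ = optimum-staller-≥ (Any.map⁺ (Any-legalMoves {h} {v = v} l k≤))

    remainingMoves-over : ¬ ∃ (Legal h) → ∀ p → remainingMoves p h (acc rs) ≤ k
    remainingMoves-over over p with legalMoves h
    ... | []     = z≤n
    ... | vl ∷ _ = contradiction vl over

-- Stated for a general graph because comparing γZg (path (2 + n)) with its
-- unfolding makes Agda evaluate the game.
γZg-elim : ∀ {n} (G : Graph n) (P : ℕ → Set) →
           (∀ a → P (ZGame.remainingMoves G dominator [] a)) → P (γZg G)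
γZg-elim G P p = p (<-wellFounded _)

-- Arithmetic of the idealised game.

-- The length of the game if Dominator takes three units and Staller one unit of
-- a stock per move.
moves : Player → ℕ → ℕ
moves _         zero                = 0
moves dominator (suc zero)          = 1
moves dominator (suc (suc zero))    = 1
moves dominator (suc (suc (suc u))) = suc (moves staller u)
moves staller   (suc u)             = suc (moves dominator u)

moves-zero : ∀ p → moves p 0 ≡ 0
moves-zero dominator = refl
moves-zero staller   = refl

moves-dominator-suc : ∀ u → moves dominator (suc u) ≡ suc (moves staller (u ∸ 2))
moves-dominator-suc zero          = refl
moves-dominator-suc (suc zero)    = refl
moves-dominator-suc (suc (suc u)) = refl

moves-mono-≤ : ∀ p {u v} → u ≤ v → moves p u ≤ moves p v
moves-mono-≤ _         {zero}                _         = z≤n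
moves-mono-≤ staller   {suc u}               (s≤s u≤v) = s≤s (moves-mono-≤ dominator u≤v)
moves-mono-≤ dominator {suc zero}            {suc v} _ rewrite moves-dominator-suc v = s≤s z≤n
moves-mono-≤ dominator {suc (suc zero)}      {suc v} _ rewrite moves-dominator-suc v = s≤s z≤n
moves-mono-≤ dominator {suc (suc (suc u))} (s≤s (s≤s (s≤s u≤v))) = s≤s (moves-mono-≤ staller u≤v)

moves-dominator-drop : ∀ {m k} → 3 + m ≤ k → suc (moves staller (m ∸ 2)) ≤ moves dominator (k ∸ 2)
moves-dominator-drop {m} {suc (suc (suc k))} (s≤s (s≤s (s≤s m≤k)))
  rewrite moves-dominator-suc k = s≤s (moves-mono-≤ staller (∸-monoˡ-≤ 2 m≤k))

-- The bound `3 ≤ k` keeps `k ∸ 2` positive, so that Staller has a unit to take.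
moves-staller-drop : ∀ {m k} → 3 ≤ k → m < k → suc (moves dominator (m ∸ 2)) ≤ moves staller (k ∸ 2)
moves-staller-drop (s≤s (s≤s (s≤s _))) (s≤s m≤2+k) =
  s≤s (moves-mono-≤ dominator (∸-monoˡ-≤ 2 m≤2+k))

-- A round takes 3 + 1 units in two moves, so passing from `n` to `4 + n` adds 2 on both sides.
moves-closed : ∀ n → (n % 4 ≡ 3 → suc (moves dominator n) ≡ ⌈ n /2⌉) ×
                     (n % 4 ≢ 3 → moves dominator n ≡ ⌈ n /2⌉)
moves-closed 0 = (λ ()) , λ _ → refl
moves-closed 1 = (λ ()) , λ _ → refl
moves-closed 2 = (λ ()) , λ _ → refl
moves-closed 3 = (λ _ → refl) , λ 3≢3 → contradiction refl 3≢3
moves-closed (suc (suc (suc (suc n)))) with moves-closed n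
... | ≡3 , ≢3 = cong (2 +_) ∘ ≡3 , cong (2 +_) ∘ ≢3

-- Counting and weighing undominated vertices.

∣∁p∣≤∣q∣+∣∁[q∪p]∣ : ∀ {n} (p q : Subset n) → ∣ ∁ p ∣ ≤ ∣ q ∣ + ∣ ∁ (q ∪ p) ∣
∣∁p∣≤∣q∣+∣∁[q∪p]∣ []            []            = z≤n
∣∁p∣≤∣q∣+∣∁[q∪p]∣ (inside  ∷ p) (inside  ∷ q) = m≤n⇒m≤1+n (∣∁p∣≤∣q∣+∣∁[q∪p]∣ p q)
∣∁p∣≤∣q∣+∣∁[q∪p]∣ (inside  ∷ p) (outside ∷ q) = ∣∁p∣≤∣q∣+∣∁[q∪p]∣ p q
∣∁p∣≤∣q∣+∣∁[q∪p]∣ (outside ∷ p) (inside  ∷ q) = s≤s (∣∁p∣≤∣q∣+∣∁[q∪p]∣ p q)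
∣∁p∣≤∣q∣+∣∁[q∪p]∣ (outside ∷ p) (outside ∷ q) =
  ≤-trans (s≤s (∣∁p∣≤∣q∣+∣∁[q∪p]∣ p q)) (≤-reflexive (sym (+-suc ∣ q ∣ _)))

Empty-∁⇒∣∁p∣≡0 : ∀ {n} {p : Subset n} → ¬ Nonempty (∁ p) → ∣ ∁ p ∣ ≡ 0
Empty-∁⇒∣∁p∣≡0 {n} empty = trans (cong ∣_∣ (Empty-unique empty)) (∣⊥∣≡0 n)

∣∁⊥∣≡n : ∀ n → ∣ ∁ (⊥ {n}) ∣ ≡ n
∣∁⊥∣≡n n = trans (∣∁p∣≡n∸∣p∣ (⊥ {n})) (cong (n ∸_) (∣⊥∣≡0 n))

-- The number of vertices outside p plus twice the number of runs they form,
-- a run being counted at its first vertex; the first argument is the side of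
-- the vertex preceding p.
weight : ∀ {n} → Side → Subset n → ℕ
weight _       []            = 0
weight _       (inside  ∷ p) = weight inside p
weight inside  (outside ∷ p) = 3 + weight outside p
weight outside (outside ∷ p) = 1 + weight outside p

weight-inside-≤ : ∀ {n} (p : Subset n) → weight inside p ≤ 2 + weight outside p
weight-inside-≤ []            = z≤n
weight-inside-≤ (inside  ∷ p) = m≤n+m _ 2
weight-inside-≤ (outside ∷ p) = ≤-refl

weight-⊥ : ∀ n → weight outside (⊥ {n}) ≡ n
weight-⊥ zero    = refl
weight-⊥ (suc n) = cong suc (weight-⊥ n)

3≤weight : ∀ {n} {p : Subset n} {x} → x ∉ p → 3 ≤ weight inside p
3≤weight {p = outside ∷ p}            _   = m≤m+n 3 _
3≤weight {p = inside  ∷ p} {zero}     x∉p = contradiction here x∉p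
3≤weight {p = inside  ∷ p} {suc x}    x∉p = 3≤weight (drop-not-there x∉p)

-- Closed neighbourhoods and moves on the path.

module Path (n : ℕ) where
  open Graph (path n) public
  open ZGame (path n) public
  open ZGameProperties (path n) public

∼-suc⁺ : ∀ {n} {v w : Fin n} → Path._∼_ n v w → Path._∼_ (suc n) (suc v) (suc w)
∼-suc⁺ (inj₁ e) = inj₁ (cong suc e)
∼-suc⁺ (inj₂ e) = inj₂ (cong suc e)

∼-suc⁻ : ∀ {n} {v w : Fin n} → Path._∼_ (suc n) (suc v) (suc w) → Path._∼_ n v w
∼-suc⁻ (inj₁ e) = inj₁ (cong pred e)
∼-suc⁻ (inj₂ e) = inj₂ (cong pred e)

∅∪⊥≡⊥ : ∀ n → tabulate {n = n} (λ _ → outside) ∪ ⊥ ≡ ⊥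
∅∪⊥≡⊥ zero    = refl
∅∪⊥≡⊥ (suc n) = cong (outside ∷_) (∅∪⊥≡⊥ n)

N[0]≡ : ∀ {n} → Path.N[_] (2 + n) zero ≡ inside ∷ inside ∷ ⊥
N[0]≡ {n} = cong (λ p → inside ∷ inside ∷ p) (∅∪⊥≡⊥ n)

N[1]≡ : ∀ {n} → Path.N[_] (3 + n) (suc zero) ≡ inside ∷ inside ∷ inside ∷ ⊥
N[1]≡ {n} = cong (λ p → inside ∷ inside ∷ inside ∷ p) (∅∪⊥≡⊥ n)

∣N[]∣≤3 : ∀ {n} (v : Fin n) → ∣ Path.N[_] n v ∣ ≤ 3
∣N[]∣≤3 {1}                 zero          = s≤s z≤n
∣N[]∣≤3 {suc (suc n)}       zero          = ≤-trans
  (≤-reflexive (trans (cong ∣_∣ (N[0]≡ {n})) (cong (2 +_) (∣⊥∣≡0 n)))) (n≤1+n 2)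
∣N[]∣≤3 {2}                 (suc zero)    = n≤1+n 2
∣N[]∣≤3 {suc (suc (suc n))} (suc zero)    =
  ≤-reflexive (trans (cong ∣_∣ (N[1]≡ {n})) (cong (3 +_) (∣⊥∣≡0 n)))
-- The neighbourhood computes to `outside` followed by that of `suc v` in the path without its first
-- vertex.
∣N[]∣≤3 {suc n}             (suc (suc v)) = ∣N[]∣≤3 {n} (suc v)

play : ∀ {n} → Fin n → Subset n → Subset n
play {n} v D = Path.N[_] n v ∪ D

play-0 : ∀ {n} y z (D : Subset n) → play zero (y ∷ z ∷ D) ≡ inside ∷ inside ∷ D
play-0 y z D = trans (cong (_∪ (y ∷ z ∷ D)) N[0]≡)
  (cong (λ p → inside ∷ inside ∷ p) (∪-identityˡ D))

play-1 : ∀ {n} x y z (D : Subset n) →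
         play (suc zero) (x ∷ y ∷ z ∷ D) ≡ inside ∷ inside ∷ inside ∷ D
play-1 x y z D = trans (cong (_∪ (x ∷ y ∷ z ∷ D)) N[1]≡)
  (cong (λ p → inside ∷ inside ∷ inside ∷ p) (∪-identityˡ D))

-- Effect of a move on the weight.

weight-outside-∷ : ∀ {n} s (p : Subset n) → weight outside p < weight s (outside ∷ p)
weight-outside-∷ inside  p = m≤n+m _ 2
weight-outside-∷ outside p = ≤-refl

-- Dominating `y` and `z` can create a run at the head of `p`, at a cost of 2, only if `z` is
-- undominated. Then either `z` starts a run of its own, worth 3, or `y` is undominated too and two
-- vertices are gained.
weight-skip-two : ∀ {n} y z (p : Subset n) → weight inside p ≤ weight outside (y ∷ z ∷ p)
weight-skip-two inside  inside  p = ≤-refl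
weight-skip-two inside  outside p = m≤n⇒m≤1+n (weight-inside-≤ p)
weight-skip-two outside inside  p = m≤n+m _ 1
weight-skip-two outside outside p = weight-inside-≤ p

weight-skip-outside : ∀ {n} y (p : Subset n) → weight inside p < weight inside (y ∷ outside ∷ p)
weight-skip-outside inside  p = s≤s (weight-inside-≤ p)
weight-skip-outside outside p = s≤s (m≤n⇒m≤1+n (weight-inside-≤ p))

-- A move at `suc v` dominates nothing before `v`, so the induction strips the earlier vertices. The
-- side `s` is arbitrary because it becomes that of the vertex stripped last.
weight-play-suc : ∀ {n} s (v : Fin n) {D : Subset (suc n)} → Path.LegalAt _ D (suc v) →
                  weight s (play (suc v) D) < weight s D
weight-play-suc s zero {x ∷ y ∷ []} (suc zero , inj₁ () , _)
weight-play-suc s zero {x ∷ y ∷ []} (suc zero , inj₂ () , _)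
weight-play-suc s zero {inside ∷ y ∷ []} (zero , _ , 0∉D) = contradiction here 0∉D
weight-play-suc inside  zero {outside ∷ _ ∷ []} (zero , _ , _) = s≤s z≤n
weight-play-suc outside zero {outside ∷ _ ∷ []} (zero , _ , _) = s≤s z≤n
weight-play-suc s zero {x ∷ y ∷ z ∷ D} l =
  subst (λ p → weight s p < weight s (x ∷ y ∷ z ∷ D)) (sym (play-1 x y z D)) (window x z l)
  where
  -- Legality forces `x` or `z` to be undominated, and either alone gives the bound, whatever `y`
  -- is.
  window : ∀ x z → Path.LegalAt _ (x ∷ y ∷ z ∷ D) (suc zero) →
           weight inside D < weight s (x ∷ y ∷ z ∷ D)
  window outside z       _ = ≤-<-trans (weight-skip-two y z D) (weight-outside-∷ s (y ∷ z ∷ D))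
  window inside  outside _ = weight-skip-outside y D
  window inside  inside (zero         , _      , 0∉D) = contradiction here 0∉D
  window inside  inside (suc zero     , inj₁ () , _)
  window inside  inside (suc zero     , inj₂ () , _)
  window inside  inside (suc (suc zero) , _     , 2∉D) = contradiction (there (there here)) 2∉D
  window inside  inside (suc (suc (suc w)) , inj₁ () , _)
  window inside  inside (suc (suc (suc w)) , inj₂ () , _)
weight-play-suc s (suc v) {D} (zero , inj₁ () , _)
weight-play-suc s (suc v) {D} (zero , inj₂ () , _)
weight-play-suc s (suc v) {inside ∷ D} (suc w , v∼w , w∉D) =
  weight-play-suc inside v (w , ∼-suc⁻ v∼w , drop-not-there w∉D)
weight-play-suc inside (suc v) {outside ∷ D} (suc w , v∼w , w∉D) =
  +-monoʳ-< 3 (weight-play-suc outside v (w , ∼-suc⁻ v∼w , drop-not-there w∉D))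
weight-play-suc outside (suc v) {outside ∷ D} (suc w , v∼w , w∉D) =
  +-monoʳ-< 1 (weight-play-suc outside v (w , ∼-suc⁻ v∼w , drop-not-there w∉D))

-- The move `zero` needs `inside` as the preceding side: after an undominated vertex it could split
-- a run by dominating only two vertices and leave the weight unchanged.
weight-play : ∀ {n} (v : Fin n) {D} → Path.LegalAt _ D v → weight inside (play v D) < weight inside D
weight-play (suc v) l = weight-play-suc inside v l
weight-play zero (zero , inj₁ () , _)
weight-play zero (zero , inj₂ () , _)
weight-play zero {y ∷ outside ∷ D} (suc zero , _ , _) =
  subst (λ p → weight inside p < weight inside (y ∷ outside ∷ D)) (sym (play-0 y outside D))
    (weight-skip-outside y D)
weight-play zero {y ∷ inside ∷ D} (suc zero , _ , 1∉D) = contradiction (there here) 1∉D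
weight-play zero (suc (suc w) , inj₁ () , _)
weight-play zero (suc (suc w) , inj₂ () , _)

-- The leftmost undominated vertex starts a run and so accounts for 3; by `weight-skip-two` the rest
-- of the weight does not grow.
dominator-move : ∀ {n} (D : Subset (2 + n)) → Nonempty (∁ D) →
             ∃ λ v → Path.LegalAt _ D v × 3 + weight inside (play v D) ≤ weight inside D
dominator-move (outside ∷ y ∷ D) _ = suc zero , (zero , inj₂ refl , λ ()) , drop y D
  where
  drop : ∀ {n} y (D : Subset n) →
          3 + weight inside (play (suc zero) (outside ∷ y ∷ D)) ≤ weight inside (outside ∷ y ∷ D)
  drop y []      = m≤m+n 3 _
  drop y (z ∷ D) =
    subst (λ p → 3 + weight inside p ≤ weight inside (outside ∷ y ∷ z ∷ D))
      (sym (play-1 outside y z D)) (+-monoʳ-≤ 3 (weight-skip-two y z D))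
dominator-move (inside ∷ outside ∷ []) _ = zero , (suc zero , inj₁ refl , λ { (there ()) }) , ≤-refl
dominator-move (inside ∷ inside ∷ []) (suc zero , there ())
dominator-move (inside ∷ y ∷ z ∷ D) (suc x , there x∉D) with dominator-move (y ∷ z ∷ D) (x , x∉D)
-- Once shifted, the move `zero` also covers the new first vertex. That vertex is already dominated,
-- so `≤w` still fits by computation.
... | zero  , (w , v∼w , w∉D) , ≤w = suc zero , (suc w , ∼-suc⁺ v∼w , w∉D ∘ drop-there) , ≤w
... | suc v , (w , v∼w , w∉D) , ≤w = suc (suc v) , (suc w , ∼-suc⁺ v∼w , w∉D ∘ drop-there) , ≤w

-- Staller's strategy.

boundary : ∀ {n} (D : Subset n) → Nonempty D → Nonempty (∁ D) →
           ∃₂ λ a b → Path._∼_ n a b × a ∈ D × b ∉ D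
boundary (inside  ∷ [])          _ (zero , ())
boundary (outside ∷ [])          (zero , ()) _
boundary (inside  ∷ outside ∷ D) _ _ = zero , suc zero , inj₁ refl , here , λ { (there ()) }
boundary (outside ∷ inside  ∷ D) _ _ = suc zero , zero , inj₂ refl , there here , λ ()
boundary (inside  ∷ inside  ∷ D) _ (suc u , there u∈) with boundary (inside ∷ D) (zero , here) (u , u∈)
... | a , b , a∼b , a∈D , b∉D = suc a , suc b , ∼-suc⁺ a∼b , there a∈D , b∉D ∘ drop-there
boundary (outside ∷ outside ∷ D) (suc d , there d∈) _ with boundary (outside ∷ D) (d , d∈) (zero , here)
... | a , b , a∼b , a∈D , b∉D = suc a , suc b , ∼-suc⁺ a∼b , there a∈D , b∉D ∘ drop-there

module _ {n : ℕ} where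
  open Path n

  neighbours-≤2 : ∀ {a b c d} → a ∼ b → a ∼ c → a ∼ d → c ≢ b → d ≢ b → c ≡ d
  neighbours-≤2 (inj₁ p) (inj₁ q) _        c≢b _   = contradiction (toℕ-injective (trans q (sym p))) c≢b
  neighbours-≤2 (inj₁ p) (inj₂ q) (inj₁ r) _   d≢b = contradiction (toℕ-injective (trans r (sym p))) d≢b
  neighbours-≤2 (inj₁ p) (inj₂ q) (inj₂ r) _   _   = toℕ-injective (suc-injective (trans (sym q) r))
  neighbours-≤2 (inj₂ p) (inj₂ q) _        c≢b _   =
    contradiction (toℕ-injective (suc-injective (trans (sym q) p))) c≢b
  neighbours-≤2 (inj₂ p) (inj₁ q) (inj₁ r) _   _   = toℕ-injective (trans q (sym r))
  neighbours-≤2 (inj₂ p) (inj₁ q) (inj₂ r) _   d≢b =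
    contradiction (toℕ-injective (suc-injective (trans (sym r) p))) d≢b

module _ {n : ℕ} where
  open Path (2 + n)

  staller-move : ∀ h → Nonempty (dominated h) → Nonempty (∁ (dominated h)) →
               ∃ λ a → Legal h a × undominated h ≤ 1 + undominated (a ∷ h)
  staller-move h D≠∅ U≠∅ with boundary (dominated h) D≠∅ U≠∅
  ... | a , b , a∼b , a∈D , b∉D with ∈dominated⁻ h a∈D
  ...   | v , a∈N[v] , N[v]⊆D = a , LegalAt⇒Legal h {a} (b , a∼b , b∉D) ,
    ≤-trans (∣∁p∣≤∣q∣+∣∁[q∪p]∣ (dominated h) ⁅ b ⁆)
      (+-mono-≤ (≤-reflexive (∣⁅x⁆∣≡1 b)) (p⊆q⇒∣p∣≤∣q∣ (p⊆q⇒∁p⊇∁q N[a]∪D⊆⁅b⁆∪D)))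
    where
    D = dominated h

    near-v∈D : ∀ {w} → v ∼ w ⊎ v ≡ w → w ∈ D
    near-v∈D v∼w⊎v≡w = N[v]⊆D (∈N[]⁺ v∼w⊎v≡w)

    v∈D : v ∈ D
    v∈D = near-v∈D (inj₂ refl)

    b∉⇒≢ : ∀ {w} → w ∈ D → w ≢ b
    b∉⇒≢ w∈D refl = b∉D w∈D

    neighbour∈⁅b⁆∪D : ∀ {w} → a ∼ w → w ∈ ⁅ b ⁆ ∪ D
    neighbour∈⁅b⁆∪D {w} a∼w with w ≟ᶠ b | ∈N[]⁻ a∈N[v]
    ... | yes refl | _        = x∈p∪q⁺ (inj₁ (x∈⁅x⁆ b))
    -- If `a` itself was played, all its neighbours are dominated.
    ... | no w≢b   | inj₂ refl = x∈p∪q⁺ (inj₂ (near-v∈D (inj₁ a∼w)))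
    -- Otherwise `v` and `w` are both neighbours of `a` other than `b`, hence equal.
    ... | no w≢b   | inj₁ v∼a =
      subst (_∈ ⁅ b ⁆ ∪ D) (neighbours-≤2 a∼b (symm v∼a) a∼w (b∉⇒≢ v∈D) w≢b)
        (x∈p∪q⁺ (inj₂ v∈D))

    N[a]∪D⊆⁅b⁆∪D : N[ a ] ∪ D ⊆ ⁅ b ⁆ ∪ D
    N[a]∪D⊆⁅b⁆∪D w∈ with x∈p∪q⁻ N[ a ] D w∈
    ... | inj₂ w∈D = x∈p∪q⁺ (inj₂ w∈D)
    ... | inj₁ w∈N[a] with ∈N[]⁻ w∈N[a]
    ...   | inj₁ a∼w  = neighbour∈⁅b⁆∪D a∼w
    ...   | inj₂ refl = x∈p∪q⁺ (inj₂ a∈D)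

  -- The two bounds on the length of the game.

  reducedWeight : History → ℕ
  reducedWeight h = weight inside (dominated h) ∸ 2

  over : ∀ {h} → ¬ Nonempty (∁ (dominated h)) → ¬ ∃ (Legal h)
  over {h} U=∅ (v , l) with Legal⇒LegalAt h {v} l
  ... | w , _ , w∉D = U=∅ (w , x∉p⇒x∈∁p w∉D)

  remainingMoves-≤ : ∀ p h a → remainingMoves p h a ≤ moves p (reducedWeight h)
  remainingMoves-≤ p h (acc rs) with nonempty? (∁ (dominated h))
  remainingMoves-≤ p h (acc rs) | no U=∅ =
    remainingMoves-over h rs (over {h} U=∅) p
  remainingMoves-≤ dominator h (acc rs) | yes U≠∅ with dominator-move (dominated h) U≠∅
  ... | v , l , drop = remainingMoves-dominator-≤ h rs v
    (LegalAt⇒Legal h {v} l)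
    λ l′ → ≤-trans (s≤s (remainingMoves-≤ staller (v ∷ h) (rs (legal⇒undominated< {h} {v} l′))))
      (moves-dominator-drop {weight inside (dominated (v ∷ h))} drop)
  remainingMoves-≤ staller h (acc rs) | yes (x , x∈U) =
    remainingMoves-staller-≤ h rs λ (v , l) →
      ≤-trans (s≤s (remainingMoves-≤ dominator (v ∷ h) (rs (legal⇒undominated< {h} {v} l))))
        (moves-staller-drop {weight inside (dominated (v ∷ h))} (3≤weight {p = dominated h} (x∈∁p⇒x∉p x∈U))
          (weight-play v {dominated h} (Legal⇒LegalAt h {v} l)))

  -- Staller's strategy needs a dominated vertex next to an undominated one, hence some earlier
  -- move.
  Started : Player → History → Set
  Started dominator _ = ⊤
  Started staller   h = Nonempty (dominated h)

  remainingMoves-≥ : ∀ p h a → Started p h → moves p (undominated h) ≤ remainingMoves p h a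
  remainingMoves-≥ p h (acc rs) _ with nonempty? (∁ (dominated h))
  remainingMoves-≥ p h (acc rs) _ | no U=∅ = ≤-trans (≤-reflexive moves≡0) z≤n
    where
    moves≡0 : moves p (undominated h) ≡ 0
    moves≡0 = trans (cong (moves p) (Empty-∁⇒∣∁p∣≡0 {p = dominated h} U=∅)) (moves-zero p)
  -- Here `dominator-move` serves only to show that the game is not over.
  remainingMoves-≥ dominator h (acc rs) _ | yes U≠∅ with dominator-move (dominated h) U≠∅
  ... | v₀ , l , _ = remainingMoves-dominator-≥ h rs v₀
    (LegalAt⇒Legal h {v₀} l)
    λ (v , l′) → ≤-trans
      (moves-mono-≤ dominator (≤-trans (∣∁p∣≤∣q∣+∣∁[q∪p]∣ (dominated h) N[ v ])
                                       (+-monoˡ-≤ _ (∣N[]∣≤3 v))))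
      (s≤s (remainingMoves-≥ staller (v ∷ h) (rs (legal⇒undominated< {h} {v} l′))
        (v , p⊆p∪q (dominated h) (∈N[]⁺ {v} (inj₂ refl)))))
  remainingMoves-≥ staller h (acc rs) D≠∅ | yes U≠∅ with staller-move h D≠∅ U≠∅
  ... | a , l , drop = remainingMoves-staller-≥ h rs a l
    λ l′ → ≤-trans (moves-mono-≤ staller drop)
      (s≤s (remainingMoves-≥ dominator (a ∷ h) (rs (legal⇒undominated< {h} {a} l′)) _))

  remainingMoves-[] : ∀ a → remainingMoves dominator [] a ≡ moves dominator (2 + n)
  -- Initially all `2 + n` vertices form one run of weight `4 + n`, so the reduced weight equals the
  -- number of undominated vertices.
  remainingMoves-[] a = ≤-antisym
    (subst (λ k → remainingMoves dominator [] a ≤ moves dominator (2 + k)) (weight-⊥ n)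
      (remainingMoves-≤ dominator [] a))
    (subst (λ k → moves dominator k ≤ remainingMoves dominator [] a) (∣∁⊥∣≡n (2 + n))
      (remainingMoves-≥ dominator [] a _))

γZg-path : ∀ n → γZg (path (2 + n)) ≡ moves dominator (2 + n)
γZg-path n = γZg-elim (path (2 + n)) (_≡ moves dominator (2 + n)) remainingMoves-[]

corollary4p3 : (n : ℕ) → 2 ≤ n →
    (n % 4 ≡ 3 → γZg (path n) ≡ ⌈ n /2⌉ ∸ 1) × (n % 4 ≢ 3 → γZg (path n) ≡ ⌈ n /2⌉)
corollary4p3 (suc (suc n)) (s≤s (s≤s z≤n)) =
    (λ n%4≡3 → trans (γZg-path n) (cong pred (proj₁ (moves-closed (2 + n)) n%4≡3)))
  , (λ n%4≢3 → trans (γZg-path n) (proj₂ (moves-closed (2 + n)) n%4≢3))
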